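{- For every $n\ge 0$, there is a bijection $\Phi:FP_n\to\mathcal D_n$, where $\mathcal D_n$ denotes the set of Dyck paths of semilength $n$.
   Context: $I_n$ is the set of inversion sequences of length $n$, i.e. integer sequences $\sigma=(\sigma_1,\ldots,\sigma_n)$ with $0\le\sigma_i<i$ for every $1\le i\le n$ (the empty sequence is allowed, with $n=0$). For a finite integer sequence $\sigma$ of length $n$, $\Theta(\sigma)$ is the sequence of length $n$ defined by $\Theta(\sigma)_i=\#\{j<i:\sigma_j<\sigma_i\}$. $FP_n=\{\sigma\in I_n:\Theta(\sigma)=\sigma\}$. A Dyck path of semilength $n$ is a word with $n$ letters $U$ (up steps) and $n$ letters $D$ (down steps) such that every prefix contains at least as many $U$'s as $D$'s. -}

module Defs where

open import Data.Fin.Base using (Fin; toℕ)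
open import Data.Fin.Properties using () renaming (_<?_ to _<ᶠ?_)
open import Data.List.Base using (List; filter; length; _++_)
open import Data.Nat.Base using (ℕ; suc; _≤_; _<_)
open import Data.Nat.Properties using (_<?_)
open import Data.Product.Base using (_×_)
open import Data.Refinement using (Refinement-syntax; value)
open import Data.Vec.Base using (Vec; lookup; tabulate; count; allFin)
open import Relation.Binary.Definitions using (DecidableEquality)
open import Relation.Binary.PropositionalEquality using (_≡_; refl)
open import Relation.Nullary.Decidable using (yes; no; _×-dec_)

-- Membership proofs in the subset types below are irrelevant (Data.Refinement),
-- so propositional equality of elements is equality of the underlying
-- sequences or words.

-- `Fin n` is 0-based: the entry σᵢ (1 ≤ i ≤ n) is `lookup σ j` with
-- i = suc (toℕ j).  The bound 0 ≤ σᵢ is built into ℕ.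
IsInversionSequence : ∀ {n} → Vec ℕ n → Set
IsInversionSequence {n} σ = (j : Fin n) → lookup σ j < suc (toℕ j)

InversionSequence : ℕ → Set
InversionSequence n = [ σ ∈ Vec ℕ n ∣ IsInversionSequence σ ]

Θ : ∀ {n} → Vec ℕ n → Vec ℕ n
Θ {n} σ = tabulate λ i →
  count (λ j → (j <ᶠ? i) ×-dec (lookup σ j <? lookup σ i)) (allFin n)

FP : ℕ → Set
FP n = [ σ ∈ InversionSequence n ∣ Θ (value σ) ≡ value σ ]

data Step : Set where
  U D : Step

_≟_ : DecidableEquality Step
U ≟ U = yes refl
U ≟ D = no λ ()
D ≟ U = no λ ()
D ≟ D = yes refl

#[_] : Step → List Step → ℕ
#[ s ] w = length (filter (_≟ s) w)

IsDyckPath : ℕ → List Step → Set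
IsDyckPath n w =
  #[ U ] w ≡ n × #[ D ] w ≡ n ×
  (∀ (p s : List Step) → p ++ s ≡ w → #[ D ] p ≤ #[ U ] p)

DyckPath : ℕ → Set
DyckPath n = [ w ∈ List Step ∣ IsDyckPath n w ]

{-# OPTIONS --safe #-}

-- Call v a candidate for a prefix of length n when exactly v entries of the
-- prefix are below v; a fixed point is built by repeatedly appending a
-- candidate.  Since entries of an inversion sequence satisfy #{j : σⱼ < u} ≥ u
-- for all u ≤ n, appending a candidate v destroys exactly the candidates above
-- v and creates exactly one, n + 1.  The candidates thus behave as a stack with
-- bottom element 0, and reading "D" as a pop and "U" as appending the top entry
-- (which pushes n + 1) turns a fixed point into a Dyck path.
module Submission where

open import Data.Bool.Base using (if_then_else_; true; false)
open import Data.Fin.Base using (Fin; zero; suc; toℕ)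
open import Data.Fin.Properties using () renaming (_<?_ to _<ᶠ?_)
open import Data.Irrelevant using ([_])
open import Data.List.Base using (List; []; _∷_; length; _++_)
open import Data.Nat.Base using (ℕ; zero; suc; _+_; _≤_; _<_; z≤n; s≤s; s≤s⁻¹)
open import Data.Nat.Properties renaming (_≟_ to _≟ℕ_)
open import Data.Product.Base using (_,_; proj₁; proj₂; Σ-syntax; ∃-syntax; map; map₂)
open import Data.Refinement using (value; value-injective; _,_)
open import Data.Sum.Base using (inj₁; inj₂)
open import Data.Vec.Base using (Vec; []; _∷_; lookup; tabulate; count)
open import Data.Vec.Properties using (lookup∘tabulate; tabulate∘lookup; tabulate-cong) renaming (≡-dec to Vec-≡-dec)
open import Function.Base using (id; _∘_)
open import Function.Bundles using (_⤖_; mk⤖)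
open import Function.Consequences.Propositional using (strictlySurjective⇒surjective)
open import Relation.Binary.PropositionalEquality
open import Relation.Nullary.Decidable using (Dec; does; yes; no; dec-true; dec-false; recompute; _×-dec_)
open import Relation.Nullary.Negation using (contradiction)
open import Relation.Nullary.Recomputable using (Recomputable)
open import Defs

private variable
  m n t t′ v : ℕ
  s : List ℕ
  σ τ : Vec ℕ m
  w x : List Step
  c c′ : ℕ → ℕ

-- A prefix ρ is represented by its counting function c u = #{j : ρⱼ < u}.

bump : ℕ → (ℕ → ℕ) → ℕ → ℕ
bump v c u = (if does (v <? u) then suc else id) (c u)

bump-< : ∀ {u} c → v < u → bump v c u ≡ suc (c u)
bump-< {v} {u} c v<u rewrite dec-true (v <? u) v<u = refl

bump-≥ : ∀ {u} c → u ≤ v → bump v c u ≡ c u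
bump-≥ {v} {u} c u≤v rewrite dec-false (v <? u) (≤⇒≯ u≤v) = refl

bump-≤ : ∀ v c u → c u ≤ bump v c u
bump-≤ v c u with v <? u
... | yes v<u = ≤-trans (n≤1+n _) (≤-reflexive (sym (bump-< c v<u)))
... | no v≮u  = ≤-reflexive (sym (bump-≥ c (≮⇒≥ v≮u)))

-- Since `c` absorbs every earlier entry, being fixed by `Θ` becomes a local condition at the head,
-- with the tail judged against the updated counts.
data FixedFrom (c : ℕ → ℕ) : Vec ℕ m → Set where
  []  : FixedFrom c []
  _∷_ : c v ≡ v → FixedFrom (bump v c) σ → FixedFrom c (v ∷ σ)

count-tabulate-cong : ∀ {A B : Set} {P : A → Set} {Q : B → Set}
  (P? : ∀ a → Dec (P a)) (Q? : ∀ b → Dec (Q b)) (f : Fin n → A) (g : Fin n → B) →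
  (∀ i → does (P? (f i)) ≡ does (Q? (g i))) →
  count P? (tabulate f) ≡ count Q? (tabulate g)
count-tabulate-cong {zero}  P? Q? f g eq = refl
count-tabulate-cong {suc n} P? Q? f g eq =
  cong₂ (λ b → if b then suc else id) (eq zero) (count-tabulate-cong P? Q? (f ∘ suc) (g ∘ suc) (eq ∘ suc))

count-tabulate-none : ∀ {A : Set} {P : A → Set} (P? : ∀ a → Dec (P a)) (f : Fin n → A) →
  (∀ i → does (P? (f i)) ≡ false) → count P? (tabulate f) ≡ 0
count-tabulate-none {zero}  P? f eq = refl
count-tabulate-none {suc n} P? f eq rewrite eq zero = count-tabulate-none P? (f ∘ suc) (eq ∘ suc)

lookup-Θ : (σ : Vec ℕ m) (i : Fin m) →
  lookup (Θ σ) i ≡ count (λ j → (j <ᶠ? i) ×-dec (lookup σ j <? lookup σ i)) (tabulate id)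
lookup-Θ σ = lookup∘tabulate _

lookup-Θ-zero : ∀ v (σ : Vec ℕ m) → lookup (Θ (v ∷ σ)) zero ≡ 0
lookup-Θ-zero {m} v σ =
  count-tabulate-none (λ j → (j <ᶠ? zero {m}) ×-dec (lookup (v ∷ σ) j <? v)) id (λ _ → refl)

-- The comparison of `v` with a later entry is counted once on each side: within `Θ` while `v` heads
-- the sequence, within `bump` once `v` has moved to the prefix.
lookup-Θ-suc : ∀ c v (σ : Vec ℕ m) i → let u = lookup σ i in
  c u + lookup (Θ (v ∷ σ)) (suc i) ≡ bump v c u + lookup (Θ σ) i
lookup-Θ-suc c v σ i = begin
  c u + lookup (Θ (v ∷ σ)) (suc i)
    ≡⟨ cong (c u +_) (lookup-Θ (v ∷ σ) (suc i)) ⟩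
  c u + (if does (v <? u) then suc else id) (count P? (tabulate suc))
    ≡⟨ cong (λ k → c u + (if does (v <? u) then suc else id) k)
         (trans (count-tabulate-cong P? Q? suc id (λ _ → refl)) (sym (lookup-Θ σ i))) ⟩
  c u + (if does (v <? u) then suc else id) (lookup (Θ σ) i)
    ≡⟨ shift (does (v <? u)) ⟩
  bump v c u + lookup (Θ σ) i ∎
  where
  open ≡-Reasoning
  u = lookup σ i
  P? = λ j → (j <ᶠ? suc i) ×-dec (lookup (v ∷ σ) j <? u)
  Q? = λ j → (j <ᶠ? i) ×-dec (lookup σ j <? u)
  shift : ∀ b {k l} → k + (if b then suc else id) l ≡ (if b then suc else id) k + l
  shift true  = +-suc _ _
  shift false = refl

Θ⇒FixedFrom : (σ : Vec ℕ m) → (∀ i → c (lookup σ i) + lookup (Θ σ) i ≡ lookup σ i) → FixedFrom c σ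
Θ⇒FixedFrom []      fix = []
Θ⇒FixedFrom {c = c} (v ∷ σ) fix =
  trans (sym (+-identityʳ (c v))) (trans (cong (c v +_) (sym (lookup-Θ-zero v σ))) (fix zero))
  ∷ Θ⇒FixedFrom σ (λ i → trans (sym (lookup-Θ-suc c v σ i)) (fix (suc i)))

FixedFrom⇒Θ : FixedFrom c σ → ∀ i → c (lookup σ i) + lookup (Θ σ) i ≡ lookup σ i
FixedFrom⇒Θ {c} {σ = v ∷ σ} (eq ∷ fix) zero =
  trans (cong (c v +_) (lookup-Θ-zero v σ)) (trans (+-identityʳ (c v)) eq)
FixedFrom⇒Θ {c} {σ = v ∷ σ} (eq ∷ fix) (suc i) = trans (lookup-Θ-suc c v σ i) (FixedFrom⇒Θ fix i)

-- Candidates c t s: t ∷ s lists in decreasing order all u ≤ t with c u ≡ u.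
data Candidates (c : ℕ → ℕ) : ℕ → List ℕ → Set where
  bottom : c 0 ≡ 0 → Candidates c 0 []
  push   : c t ≡ t → t′ < t → (∀ {v} → t′ < v → v < t → c v ≢ v) →
           Candidates c t′ s → Candidates c t (t′ ∷ s)

top-fixed : Candidates c t s → c t ≡ t
top-fixed (bottom eq)     = eq
top-fixed (push eq _ _ _) = eq

candidates-cong : (∀ {v} → v ≤ t → c v ≡ c′ v) → Candidates c t s → Candidates c′ t s
candidates-cong c≗c′ (bottom eq) = bottom (trans (sym (c≗c′ z≤n)) eq)
candidates-cong c≗c′ (push eq t′<t gap cs) =
  push (trans (sym (c≗c′ ≤-refl)) eq) t′<t
       (λ t′<v v<t eq′ → gap t′<v v<t (trans (c≗c′ (<⇒≤ v<t)) eq′))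
       (candidates-cong (λ v≤t′ → c≗c′ (≤-trans v≤t′ (<⇒≤ t′<t))) cs)

-- The invariants of the counting function of a prefix. By `low`, raising the count at some u ≤ n
-- leaves it above u, so u is not a candidate afterwards; by `high`, no candidate exceeds `n`.
record Prefix (n : ℕ) (c : ℕ → ℕ) : Set where
  field
    low  : ∀ {u} → u ≤ n → u ≤ c u
    high : ∀ {u} → n < u → c u ≡ n

open Prefix

empty : Prefix 0 (λ _ → 0)
empty = record { low = id ; high = λ _ → refl }

fixed⇒≤ : Prefix n c → c v ≡ v → v ≤ n
fixed⇒≤ {n} {v = v} p eq with v ≤? n
... | yes v≤n = v≤n
... | no v≰n  = ≤-reflexive (trans (sym eq) (high p (≰⇒> v≰n)))

bump-last : Prefix n c → v ≤ n → bump v c (suc n) ≡ suc n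
bump-last {c = c} p v≤n = trans (bump-< c (s≤s v≤n)) (cong suc (high p ≤-refl))

extend : Prefix n c → v ≤ n → Prefix (suc n) (bump v c)
extend {n} {c} {v} p v≤n = record { low = low′ ; high = high′ }
  where
  low′ : ∀ {u} → u ≤ suc n → u ≤ bump v c u
  low′ u≤1+n with m≤n⇒m<n∨m≡n u≤1+n
  ... | inj₁ u<1+n = ≤-trans (low p (s≤s⁻¹ u<1+n)) (bump-≤ v c _)
  ... | inj₂ refl  = ≤-reflexive (sym (bump-last p v≤n))
  high′ : ∀ {u} → suc n < u → bump v c u ≡ suc n
  high′ n<u = trans (bump-< c (≤-trans (s≤s v≤n) (<⇒≤ n<u))) (cong suc (high p (<⇒≤ n<u)))

-- Up to `t` the counts are unchanged, so the stack survives; strictly between `t` and `suc n` they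
-- rise past their argument; at `suc n` all entries are counted, giving the new top. Lower
-- candidates are appended only after popping down to them.
candidates-append : Prefix n c → Candidates c t s → Candidates (bump t c) (suc n) (t ∷ s)
candidates-append {n} {c} {t} p cs = push (bump-last p t≤n) (s≤s t≤n) gap
  (candidates-cong (λ v≤t → sym (bump-≥ c v≤t)) cs)
  where
  t≤n = fixed⇒≤ p (top-fixed cs)
  gap : ∀ {v} → t < v → v < suc n → bump t c v ≢ v
  gap t<v v<1+n eq =
    <⇒≢ (s≤s (low p (s≤s⁻¹ v<1+n))) (sym (trans (sym (bump-< c t<v)) eq))

root : Candidates (λ _ → 0) 0 []
root = bottom refl

-- σ completes a prefix of length n, and w is the part of the path still to be
-- read when the stack of remaining candidates is t ∷ s.
data Encodes (n t : ℕ) : List ℕ → Vec ℕ m → List Step → Set where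
  done : Encodes n t [] [] []
  up   : Encodes (suc n) (suc n) (t ∷ s) σ w → Encodes n t s (t ∷ σ) (U ∷ w)
  down : Encodes n t′ s σ w → Encodes n t (t′ ∷ s) σ (D ∷ w)

-- With no entries left, the path descends by popping everything above the bottom 0.
encode-[] : Candidates c t s → ∃[ w ] Encodes n t s [] w
encode-[] (bottom _)      = _ , done
encode-[] (push _ _ _ cs) = map (D ∷_) down (encode-[] cs)

encode-∷ : Prefix n c → Candidates c t s → c v ≡ v → v ≤ t → FixedFrom (bump v c) σ →
           ∃[ w ] Encodes n t s (v ∷ σ) w
encode-top : Prefix n c → Candidates c t s → FixedFrom (bump t c) σ →
             ∃[ w ] Encodes n t s (t ∷ σ) w

encode-∷ {t = t} {v = v} p cs eq v≤t fix with m≤n⇒m<n∨m≡n v≤t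
encode-∷ p cs eq _ fix | inj₂ refl = encode-top p cs fix
-- No candidate lies strictly between `t′` and `t`, so `v` is at most `t′` and popping `t` cannot
-- lose it.
encode-∷ {v = v} p (push _ _ gap cs) eq _ fix | inj₁ v<t =
  map (D ∷_) down (encode-∷ p cs eq (≮⇒≥ λ t′<v → gap t′<v v<t eq) fix)

encode-top p cs []         = map (U ∷_) up (encode-[] (candidates-append p cs))
encode-top p cs (eq ∷ fix) = map (U ∷_) up (encode-∷ p′ (candidates-append p cs) eq (fixed⇒≤ p′ eq) fix)
  where p′ = extend p (fixed⇒≤ p (top-fixed cs))

-- The Dyck conditions, generalized to a path starting at height `length s`, so that the induction
-- can run over suffixes.
decode : ∀ m s w → #[ U ] w ≡ m → #[ D ] w ≡ length s + m →
         (∀ p q → p ++ q ≡ w → #[ D ] p ≤ length s + #[ U ] p) →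
         Σ[ σ ∈ Vec ℕ m ] Encodes n t s σ w
decode zero [] [] u d pre = [] , done
decode zero (_ ∷ _) [] u () pre
decode (suc m) s (U ∷ w) u d pre =
  let σ , e = decode m (_ ∷ s) w (suc-injective u) (trans d (+-suc _ m))
                (λ p q eq → ≤-trans (pre (U ∷ p) q (cong (U ∷_) eq)) (≤-reflexive (+-suc _ _)))
  in _ , up e
-- Popping the bottom would take the path below height 0, which the prefix `D ∷ []` rules out.
decode m [] (D ∷ w) u d pre = contradiction (pre (D ∷ []) w refl) λ ()
decode m (_ ∷ s) (D ∷ w) u d pre =
  map₂ down (decode m s w u (suc-injective d)
    (λ p q eq → s≤s⁻¹ (pre (D ∷ p) q (cong (D ∷_) eq))))

Encodes-functionalˡ : Encodes n t s σ w → Encodes n t s τ w → σ ≡ τ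
Encodes-functionalˡ done     done     = refl
Encodes-functionalˡ (up e)   (up f)   = cong (_ ∷_) (Encodes-functionalˡ e f)
Encodes-functionalˡ (down e) (down f) = Encodes-functionalˡ e f

Encodes-head≤ : Candidates c t s → Encodes n t s (v ∷ σ) w → v ≤ t
Encodes-head≤ cs                   (up e)   = ≤-refl
Encodes-head≤ (push _ t′<t _ cs) (down e) = ≤-trans (Encodes-head≤ cs e) (<⇒≤ t′<t)

-- The next entry dictates the letter: `U` appends the top `t`, whereas after a pop every appendable
-- entry is at most `t′`, and candidates strictly decrease down the stack.
Encodes-functionalʳ : Prefix n c → Candidates c t s →
                      Encodes n t s σ w → Encodes n t s σ x → w ≡ x
Encodes-functionalʳ p cs done   done   = refl
Encodes-functionalʳ p cs (up e) (up f) =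
  cong (U ∷_) (Encodes-functionalʳ (extend p (fixed⇒≤ p (top-fixed cs))) (candidates-append p cs) e f)
Encodes-functionalʳ p (push _ t′<t _ cs) (up e) (down f) =
  contradiction (Encodes-head≤ cs f) (<⇒≱ t′<t)
Encodes-functionalʳ p (push _ t′<t _ cs) (down e) (up f) =
  contradiction (Encodes-head≤ cs e) (<⇒≱ t′<t)
Encodes-functionalʳ p (push _ _ _ cs) (down e) (down f) =
  cong (D ∷_) (Encodes-functionalʳ p cs e f)

Encodes⇒FixedFrom : Prefix n c → Candidates c t s → Encodes n t s σ w → FixedFrom c σ
Encodes⇒FixedFrom p cs done   = []
Encodes⇒FixedFrom p cs (up e) = top-fixed cs ∷
  Encodes⇒FixedFrom (extend p (fixed⇒≤ p (top-fixed cs))) (candidates-append p cs) e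
Encodes⇒FixedFrom p (push _ _ _ cs) (down e) = Encodes⇒FixedFrom p cs e

Encodes⇒#U : {σ : Vec ℕ m} → Encodes n t s σ w → #[ U ] w ≡ m
Encodes⇒#U done     = refl
Encodes⇒#U (up e)   = cong suc (Encodes⇒#U e)
Encodes⇒#U (down e) = Encodes⇒#U e

Encodes⇒#D : {σ : Vec ℕ m} → Encodes n t s σ w → #[ D ] w ≡ length s + m
Encodes⇒#D done     = refl
Encodes⇒#D (up e)   = trans (Encodes⇒#D e) (sym (+-suc _ _))
Encodes⇒#D (down e) = cong suc (Encodes⇒#D e)

Encodes⇒prefix : Encodes n t s σ w → ∀ p q → p ++ q ≡ w → #[ D ] p ≤ length s + #[ U ] p
Encodes⇒prefix e        []      q eq   = z≤n
Encodes⇒prefix (up e)   (U ∷ p) q refl = ≤-trans (Encodes⇒prefix e p q refl) (≤-reflexive (sym (+-suc _ _)))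
Encodes⇒prefix (down e) (D ∷ p) q refl = s≤s (Encodes⇒prefix e p q refl)

-- Entry `i` is a candidate for a prefix of length `n + toℕ i`, hence at most that length; at `n` =
-- 0 this is the inversion sequence bound.
FixedFrom⇒bound : Prefix n c → FixedFrom c σ → ∀ i → lookup σ i ≤ n + toℕ i
FixedFrom⇒bound p (eq ∷ fix) zero    = ≤-trans (fixed⇒≤ p eq) (m≤m+n _ 0)
FixedFrom⇒bound p (eq ∷ fix) (suc i) =
  ≤-trans (FixedFrom⇒bound (extend p (fixed⇒≤ p eq)) fix i) (≤-reflexive (sym (+-suc _ _)))

fixedPoint : {σ : Vec ℕ n} → FixedFrom (λ _ → 0) σ → FP n
fixedPoint {σ = σ} fix = (σ , [ (λ j → s≤s (FixedFrom⇒bound empty fix j)) ]) , [ Θσ≡σ ]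
  where
  Θσ≡σ : Θ σ ≡ σ
  Θσ≡σ = trans (sym (tabulate∘lookup (Θ σ)))
           (trans (tabulate-cong (FixedFrom⇒Θ fix)) (tabulate∘lookup σ))

FP⇒FixedFrom : (σ : FP n) → FixedFrom (λ _ → 0) (value (value σ))
FP⇒FixedFrom ((σ , _) , [ Θσ≡σ ]) = Θ⇒FixedFrom σ
  -- Decidable equality of vectors turns the irrelevant fixed-point proof into a usable one.
  (λ i → cong (λ τ → lookup τ i) (recompute (Vec-≡-dec _≟ℕ_ (Θ σ) σ) Θσ≡σ))

-- Decidability is applied to each numerical (in)equality separately, and for the prefix condition
-- at each given prefix.
IsDyckPath-recomputable : Recomputable (IsDyckPath n w)
IsDyckPath-recomputable d =
  recompute (_ ≟ℕ _) (proj₁ d) , recompute (_ ≟ℕ _) (proj₁ (proj₂ d)) ,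
  λ p q eq → recompute (_ ≤? _) (proj₂ (proj₂ d) p q eq)

encodeFP : (σ : FP n) → ∃[ w ] Encodes 0 0 [] (value (value σ)) w
encodeFP σ with value (value σ) | FP⇒FixedFrom σ
... | []    | []       = encode-[] root
... | _ ∷ _ | eq ∷ fix = encode-∷ empty root eq (fixed⇒≤ empty eq) fix

toDyck : FP n → DyckPath n
toDyck σ = let w , e = encodeFP σ in w , [ (Encodes⇒#U e , Encodes⇒#D e , Encodes⇒prefix e) ]

theorem4p9 : (n : ℕ) → FP n ⤖ DyckPath n
theorem4p9 n = mk⤖ {to = toDyck} (injective , strictlySurjective⇒surjective surjective)
  where
  injective : ∀ {σ τ : FP n} → toDyck σ ≡ toDyck τ → σ ≡ τ
  injective {σ} {τ} eq = value-injective (value-injective (Encodes-functionalˡ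
    (proj₂ (encodeFP σ))
    (subst (Encodes 0 0 [] _) (sym (cong value eq)) (proj₂ (encodeFP τ)))))

  surjective : ∀ w → ∃[ σ ] toDyck {n} σ ≡ w
  surjective (w , [ isDyck ]) =
    let #U≡n , #D≡n , pre = IsDyckPath-recomputable isDyck
        σ , e = decode n [] w #U≡n #D≡n pre
        σ′ = fixedPoint (Encodes⇒FixedFrom empty root e)
    in σ′ , value-injective (Encodes-functionalʳ empty root (proj₂ (encodeFP σ′)) e)
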